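{- For a solid weak BCC-algebra $(X,*,0)$ the following conditions are equivalent: (a) $X$ is branchwise commutative; (b) $x*y=x*(y*(y*x))$ for all $x,y$ belonging to the same branch; (c) $x=y*(y*x)$ for all $x,y\in X$ with $x\leqslant y$; (d) $x*(x*y)=y*(y*(x*(x*y)))$ for all $x,y$ belonging to the same branch.
   Context: A weak BCC-algebra is a set $X$ with a binary operation $*$ and a constant $0$ satisfying, for all $x,y,z\in X$: (i) $((x*y)*(z*y))*(x*z)=0$; (ii) $x*x=0$; (iii) $x*0=x$; (iv) $x*y=y*x=0$ implies $x=y$. The relation $x\leqslant y$ iff $x*y=0$ is a partial order on $X$. Let $I(X)$ be the set of minimal elements of $X$ with respect to $\leqslant$. For $a\in I(X)$ the branch initiated by $a$ is $B(a)=\{x\in X: a\leqslant x\}$; "belonging to the same branch" means lying in a common $B(a)$. A weak BCC-algebra is called (left) solid if $(x*y)*z=(x*z)*y$ holds for all $x,y$ belonging to the same branch and all $z\in X$. It is called branchwise commutative if $x*(x*y)=y*(y*x)$ holds for all $x,y$ belonging to the same branch. -}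

module Defs where

open import Level using (Level; _⊔_) renaming (suc to lsuc)
open import Algebra.Core using (Op₂)
open import Algebra.Structures using (IsMagma)
open import Data.Product using (_×_; ∃-syntax)
open import Relation.Binary.Core using (Rel)
open import Relation.Unary using (Pred; _∈_)

-- As for the algebraic bundles of the standard library, the underlying set is
-- a setoid; isMagma says that _≈_ is an equivalence respected by _*_.
record WeakBCCAlgebra (c ℓ : Level) : Set (lsuc (c ⊔ ℓ)) where
  infixl 7 _*_
  infix  4 _≈_
  field
    Carrier : Set c
    _≈_     : Rel Carrier ℓ
    _*_     : Op₂ Carrier
    0#      : Carrier
    isMagma : IsMagma _≈_ _*_
    bcc        : ∀ x y z → ((x * y) * (z * y)) * (x * z) ≈ 0#
    *-self     : ∀ x → x * x ≈ 0#
    *-identityʳ : ∀ x → x * 0# ≈ x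
    *-antisym  : ∀ x y → x * y ≈ 0# → y * x ≈ 0# → x ≈ y

  open IsMagma isMagma public
    using (isEquivalence; setoid; refl; sym; trans; ∙-cong; ∙-congˡ; ∙-congʳ)

module _ {c ℓ : Level} (X : WeakBCCAlgebra c ℓ) where
  open WeakBCCAlgebra X

  infix 4 _≤_
  _≤_ : Rel Carrier ℓ
  x ≤ y = x * y ≈ 0#

  -- The set I(X) of minimal elements.
  I : Pred Carrier (c ⊔ ℓ)
  I a = ∀ x → x ≤ a → x ≈ a

  -- B a is called a branch only when a ∈ I.
  B : Carrier → Pred Carrier ℓ
  B a x = a ≤ x

  SameBranch : Rel Carrier (c ⊔ ℓ)
  SameBranch x y = ∃[ a ] (a ∈ I × x ∈ B a × y ∈ B a)

  Solid : Set (c ⊔ ℓ)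
  Solid = ∀ x y z → SameBranch x y → (x * y) * z ≈ (x * z) * y

  BranchwiseCommutative : Set (c ⊔ ℓ)
  BranchwiseCommutative = ∀ x y → SameBranch x y → x * (x * y) ≈ y * (y * x)

{-# OPTIONS --safe #-}

-- For x, y in one branch, 0 ≤ x * y, and solidity makes x * (x * y) a lower bound of x and y.
-- Condition (c) makes it the greatest one, whence commutativity; the other conditions
-- reduce to (c), except that (b) also uses x * (x * (x * y)) ≈ x * y.
-- The one structural point is that x ≤ y puts x and y in a common branch. It is initiated by
-- 0 * (0 * x), which is minimal because z ↦ 0 * z identifies comparable elements.
module Submission where

open import Defs
open import Level using (Level)
open import Data.Product using (_×_; _,_)
open import Function.Bundles using (_⇔_; mk⇔)
import Relation.Binary.Reasoning.Setoid as SetoidReasoning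

module WeakBCCProperties {c ℓ : Level} (X : WeakBCCAlgebra c ℓ) where
  open WeakBCCAlgebra X
  open SetoidReasoning setoid

  infix 4 _⊑_
  _⊑_ : Carrier → Carrier → Set ℓ
  _⊑_ = _≤_ X

  ⊑-refl : ∀ {x} → x ⊑ x
  ⊑-refl = *-self _

  ⊑-respʳ : ∀ {x y z} → y ≈ z → x ⊑ y → x ⊑ z
  ⊑-respʳ y≈z x⊑y = trans (∙-congˡ (sym y≈z)) x⊑y

  ⊑-respˡ : ∀ {x y z} → x ≈ z → x ⊑ y → z ⊑ y
  ⊑-respˡ x≈z x⊑y = trans (∙-congʳ (sym x≈z)) x⊑y

  *-monoˡ : ∀ {x y} z → x ⊑ y → x * z ⊑ y * z
  *-monoˡ {x} {y} z x⊑y = begin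
    (x * z) * (y * z)            ≈⟨ *-identityʳ _ ⟨
    (x * z) * (y * z) * 0#       ≈⟨ ∙-congˡ x⊑y ⟨
    (x * z) * (y * z) * (x * y)  ≈⟨ bcc x z y ⟩
    0#                           ∎

  *-antiʳ : ∀ {x y} z → x ⊑ y → z * y ⊑ z * x
  *-antiʳ {x} {y} z x⊑y =
    ⊑-respˡ (trans (∙-congˡ x⊑y) (*-identityʳ _)) (bcc z y x)

  ⊑-trans : ∀ {x y z} → x ⊑ y → y ⊑ z → x ⊑ z
  ⊑-trans {x} {y} {z} x⊑y y⊑z =
    trans (sym (*-identityʳ _)) (⊑-respʳ y⊑z (*-monoˡ z x⊑y))

  0-minimal : I X 0#
  0-minimal x x⊑0 = trans (sym (*-identityʳ x)) x⊑0

  0*0*-deflationary : ∀ x → 0# * (0# * x) ⊑ x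
  0*0*-deflationary x =
    ⊑-respʳ (*-identityʳ x) (⊑-respˡ (∙-congʳ (*-self x)) (bcc x x 0#))

  -- The Galois-connection argument: `0# * _` reverses the order and its square lies below the
  -- identity.
  0*-triple : ∀ x → 0# * (0# * (0# * x)) ≈ 0# * x
  0*-triple x = *-antisym _ _ (0*0*-deflationary (0# * x)) (*-antiʳ 0# (0*0*-deflationary x))

  sameBranch-sym : ∀ {x y} → SameBranch X x y → SameBranch X y x
  sameBranch-sym (a , a∈I , a⊑x , a⊑y) = a , a∈I , a⊑y , a⊑x

  -- From `a ⊑ y` the product `a * y` vanishes, and from `a ⊑ x` it lies below `x * y`.
  sameBranch⇒0⊑* : ∀ {x y} → SameBranch X x y → 0# ⊑ x * y
  sameBranch⇒0⊑* {y = y} (a , _ , a⊑x , a⊑y) = ⊑-respˡ a⊑y (*-monoˡ y a⊑x)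

module SolidProperties {c ℓ : Level} (X : WeakBCCAlgebra c ℓ) (solid : Solid X) where
  open WeakBCCAlgebra X
  open WeakBCCProperties X
  open SetoidReasoning setoid

  -- The hypothesis puts `0#` and `w` in the branch of `0#`, so solidity lets `w` act on `0#` first.
  0*-absorbs : ∀ {w} z → 0# ⊑ w → (0# * z) * w ≈ 0# * z
  0*-absorbs {w} z 0⊑w = begin
    (0# * z) * w  ≈⟨ solid 0# w z (0# , 0-minimal , ⊑-refl , 0⊑w) ⟨
    (0# * w) * z  ≈⟨ ∙-congʳ 0⊑w ⟩
    0# * z        ∎

  ⊑⇒0*-≈ : ∀ {x y} → x ⊑ y → 0# * x ≈ 0# * y
  ⊑⇒0*-≈ {x} {y} x⊑y = *-antisym _ _
    -- `bcc` gives `(0# * x) * (y * x) ⊑ 0# * y`. As `0# ≈ x * x ⊑ y * x`, the factor `y * x` is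
    -- absorbed.
    (⊑-respˡ (0*-absorbs x (⊑-respˡ (*-self x) (*-monoˡ x x⊑y))) (bcc 0# x y))
    (*-antiʳ 0# x⊑y)

  0*0*-minimal : ∀ x → I X (0# * (0# * x))
  0*0*-minimal x u u⊑0*0*x = *-antisym _ _ u⊑0*0*x
    -- Comparability forces `0# * u ≈ 0# * x`, so `0# * (0# * x) ≈ 0# * (0# * u)`, which lies below
    -- `u`.
    (⊑-respˡ (∙-congˡ (trans (⊑⇒0*-≈ u⊑0*0*x) (0*-triple x))) (0*0*-deflationary u))

  ⊑⇒sameBranch : ∀ {x y} → x ⊑ y → SameBranch X x y
  ⊑⇒sameBranch {x} x⊑y =
    0# * (0# * x) , 0*0*-minimal x , 0*0*-deflationary x , ⊑-trans (0*0*-deflationary x) x⊑y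

  x*[x*y]⊑y : ∀ {x y} → SameBranch X x y → x * (x * y) ⊑ y
  x*[x*y]⊑y {x} {y} x~y = trans (sym (solid x y (x * y) x~y)) (*-self (x * y))

  x*[x*y]⊑x : ∀ {x y} → SameBranch X x y → x * (x * y) ⊑ x
  x*[x*y]⊑x {x} {y} x~y = begin
    x * (x * y) * x  ≈⟨ solid x x (x * y) (⊑⇒sameBranch ⊑-refl) ⟨
    x * x * (x * y)  ≈⟨ ∙-congʳ (*-self x) ⟩
    0# * (x * y)     ≈⟨ sameBranch⇒0⊑* x~y ⟩
    0#               ∎

  x*[x*[x*y]]≈x*y : ∀ {x y} → SameBranch X x y → x * (x * (x * y)) ≈ x * y
  x*[x*[x*y]]≈x*y {x} {y} x~y = *-antisym _ _
    (x*[x*[x*y]]⊑x*y (⊑⇒sameBranch (x*[x*y]⊑x x~y)))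
    (*-antiʳ x (x*[x*y]⊑y x~y))
    where
    x*[x*[x*y]]⊑x*y : SameBranch X (x * (x * y)) x → x * (x * (x * y)) ⊑ x * y
    x*[x*[x*y]]⊑x*y u~x = begin
      -- Solidity is applied to `x` and `x * (x * y)`, which share a branch because they are
      -- comparable.
      x * (x * (x * y)) * (x * y)    ≈⟨ solid x _ (x * y) (sameBranch-sym u~x) ⟩
      x * (x * y) * (x * (x * y))    ≈⟨ *-self _ ⟩
      0#                             ∎

theorem3p6 : ∀ {c ℓ : Level} (X : WeakBCCAlgebra c ℓ) → Solid X →
    let open WeakBCCAlgebra X
        condA = BranchwiseCommutative X
        condB = ∀ x y → SameBranch X x y → x * y ≈ x * (y * (y * x))
        condC = ∀ x y → _≤_ X x y → x ≈ y * (y * x)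
        condD = ∀ x y → SameBranch X x y → x * (x * y) ≈ y * (y * (x * (x * y)))
    in (condA ⇔ condB) × (condA ⇔ condC) × (condA ⇔ condD)
theorem3p6 X solid =
  mk⇔ a⇒b (λ b → c⇒a (b⇒c b)) , mk⇔ a⇒c c⇒a , mk⇔ (λ a → c⇒d (a⇒c a)) (λ d → c⇒a (d⇒c d))
  where
  open WeakBCCAlgebra X
  open WeakBCCProperties X
  open SolidProperties X solid

  A = BranchwiseCommutative X
  B′ = ∀ x y → SameBranch X x y → x * y ≈ x * (y * (y * x))
  C = ∀ x y → x ⊑ y → x ≈ y * (y * x)
  D = ∀ x y → SameBranch X x y → x * (x * y) ≈ y * (y * (x * (x * y)))

  x*[x*y]≈x : ∀ {x y} → x ⊑ y → x * (x * y) ≈ x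
  x*[x*y]≈x x⊑y = trans (∙-congˡ x⊑y) (*-identityʳ _)

  a⇒b : A → B′
  a⇒b a x y x~y = trans (sym (x*[x*[x*y]]≈x*y x~y)) (∙-congˡ (a x y x~y))

  a⇒c : A → C
  a⇒c a x y x⊑y = trans (sym (x*[x*y]≈x x⊑y)) (a x y (⊑⇒sameBranch x⊑y))

  b⇒c : B′ → C
  b⇒c b x y x⊑y = *-antisym _ _
    -- Both sides of (b) vanish when `x ⊑ y`, which says `x ⊑ y * (y * x)`.
    (trans (sym (b x y x~y)) x⊑y)
    (x*[x*y]⊑y (sameBranch-sym x~y))
    where x~y = ⊑⇒sameBranch x⊑y

  c⇒d : C → D
  c⇒d c x y x~y = c _ y (x*[x*y]⊑y x~y)

  d⇒c : D → C
  -- For `x ⊑ y` the element `x * (x * y)` collapses to `x`, turning (d) into (c).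
  d⇒c d x y x⊑y = trans (sym u≈x) (trans (d x y (⊑⇒sameBranch x⊑y)) (∙-congˡ (∙-congˡ u≈x)))
    where u≈x = x*[x*y]≈x x⊑y

  c⇒a : C → A
  c⇒a c x y x~y = *-antisym _ _ (below x~y) (below (sameBranch-sym x~y))
    where
    below : ∀ {x y} → SameBranch X x y → x * (x * y) ⊑ y * (y * x)
    below {x} {y} x~y =
      -- With `u = x * (x * y)`, (c) rewrites `u` as `y * (y * u)`. The map `y * (y * _)` is
      -- monotone, being antitone twice, and `u ⊑ x`.
      ⊑-respˡ (sym (c _ y (x*[x*y]⊑y x~y))) (*-antiʳ y (*-antiʳ y (x*[x*y]⊑x x~y)))
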